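{- Let $k\ge 1$ be an integer. We have $\underline{\mathcal{F}_k}=\bigcup_{\omega\in\Omega'_k}\left(S_\omega\setminus id_{A^*}\right)$.
   Context: $A$ is a finite alphabet with $|A|\ge 2$; $A^*$ is the free monoid over $A$ and $|w|$ is the length of $w$. $id_{A^*}=\{(w,w):w\in A^*\}$. $(w,w')\in\mathcal{F}_k$ iff $|w|+|w'|-2|f|\le k$, where $f$ is a maximum length common factor (contiguous subword) of $w$ and $w'$; $\underline{\mathcal{F}_k}=\mathcal{F}_k\setminus id_{A^*}$. $\Omega_k$ is the (finite) set of all tuples $(u,u',v,v')$ of words of $A^*$ with $0\le|u|+|u'|+|v|+|v'|\le k$, and $\Omega'_k$ is the set of those $(u,u',v,v')\in\Omega_k$ for which at least one of $u\ne u'$ or $v\ne v'$ holds. For $\omega=(u,u',v,v')\in\Omega_k$, $S_\omega=\{(ugv,u'gv'):g\in A^*\}$. -}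

module Defs where

open import Level using (Level)
open import Data.List.Base using (List; _++_; length)
open import Data.List.Relation.Binary.Infix.Heterogeneous using (Infix)
open import Data.Nat.Base using (ℕ; _+_; _*_; _∸_; _≤_)
open import Data.Product.Base using (_×_; _,_; ∃; ∃-syntax)
open import Data.Sum.Base using (_⊎_)
open import Relation.Binary.PropositionalEquality.Core using (_≡_; _≢_)
open import Relation.Unary using (Pred; _∖_)

private
  variable
    a : Level
    A : Set a

-- Words are lists: A* is the free monoid List A under _++_.
Word : Set a → Set a
Word A = List A

∣_∣ : Word A → ℕ
∣ w ∣ = length w

idA* : Pred (Word A × Word A) _
idA* (w , w′) = w ≡ w′

-- Contiguous subwords; the empty word is a factor of every word.
_IsFactorOf_ : Word A → Word A → Set _
f IsFactorOf w = Infix _≡_ f w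

IsCommonFactor : Word A → Word A → Word A → Set _
IsCommonFactor w w′ f = f IsFactorOf w × f IsFactorOf w′

IsMaxCommonFactor : Word A → Word A → Word A → Set _
IsMaxCommonFactor w w′ f =
  IsCommonFactor w w′ f × (∀ g → IsCommonFactor w w′ g → ∣ g ∣ ≤ ∣ f ∣)

-- The subtraction never truncates: f is a factor of both w and w′, so
-- 2 * ∣ f ∣ ≤ ∣ w ∣ + ∣ w′ ∣.
𝓕 : ℕ → Pred (Word A × Word A) _
𝓕 k (w , w′) =
  ∃[ f ] IsMaxCommonFactor w w′ f × (∣ w ∣ + ∣ w′ ∣) ∸ 2 * ∣ f ∣ ≤ k

-- The irreflexive part of 𝓕 k (underlined in the usual notation).
𝓕̲ : ℕ → Pred (Word A × Word A) _
𝓕̲ k = 𝓕 k ∖ idA*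

-- Tuples (u , u′ , v , v′): left contexts first, then right contexts.
Quad : Set a → Set a
Quad A = Word A × Word A × Word A × Word A

Ω : ℕ → Pred (Quad A) _
Ω k (u , u′ , v , v′) =
  0 ≤ ∣ u ∣ + ∣ u′ ∣ + ∣ v ∣ + ∣ v′ ∣ × ∣ u ∣ + ∣ u′ ∣ + ∣ v ∣ + ∣ v′ ∣ ≤ k

Ω′ : ℕ → Pred (Quad A) _
Ω′ k ω@(u , u′ , v , v′) = Ω k ω × (u ≢ u′ ⊎ v ≢ v′)

S : Quad A → Pred (Word A × Word A) _
S (u , u′ , v , v′) (w , w′) =
  ∃[ g ] w ≡ u ++ g ++ v × w′ ≡ u′ ++ g ++ v′

{-# OPTIONS --safe #-}
module Submission where

open import Defs
open import Level using (Level)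
open import Data.Fin.Base using (Fin)
open import Data.Nat.Base using (ℕ; _≤_)
open import Data.Product.Base using (_,_; ∃)
open import Function.Bundles using (_↔_)
open import Relation.Unary using (_≐_; _∖_; ⋃)

open import Data.Fin.Properties using (inj⇒≟)
open import Data.List.Base
  using (List; []; _∷_; _++_; concatMap; filter; inits; tails)
open import Data.List.Extrema.Nat using (argmax; argmax-all; f[xs]≤f[argmax])
open import Data.List.Membership.Propositional using (_∈_)
open import Data.List.Membership.Propositional.Properties
  using (∈-++⁺ˡ; ∈-++⁺ʳ; ∈-map⁺; ∈-filter⁺; ∈-filter⁻)
open import Data.List.Properties using (length-++; ≡-dec)
open import Data.List.Relation.Binary.Infix.Heterogeneous
  using (here; there; MkView; toView; fromView)
open import Data.List.Relation.Binary.Infix.Heterogeneous.Properties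
  using (infix?)
open import Data.List.Relation.Binary.Pointwise
  using (Pointwise-≡⇒≡; ≡⇒Pointwise-≡)
open import Data.List.Relation.Binary.Prefix.Heterogeneous
  using (Prefix; []; _∷_)
import Data.List.Relation.Unary.All as All
import Data.List.Relation.Unary.Any as Any
open import Data.Nat.Base using (_+_; _*_; _∸_; z≤n)
open import Data.Nat.Properties
  using (≤-trans; ≤-reflexive; ∸-monoʳ-≤; *-monoʳ-≤; m+n∸n≡m)
open import Data.Nat.Solver using (module +-*-Solver)
open import Data.Product.Base using (∃-syntax; proj₂)
open import Data.Sum.Base using (_⊎_; inj₁; inj₂)
open import Function.Properties.Inverse using (↔⇒↣)
open import Relation.Binary.Definitions using (DecidableEquality)
open import Relation.Binary.PropositionalEquality
  using (_≡_; _≢_; refl; sym; trans; cong; cong₂)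
open import Relation.Nullary using (yes; no; _×-dec_)

private
  variable
    a : Level
    A : Set a

-- Deleting an occurrence of a common factor `g` from each of `w = u ++ g ++ v` and
-- `w′ = u′ ++ g ++ v′` leaves contexts of total length `∣ w ∣ + ∣ w′ ∣ ∸ 2 * ∣ g ∣`
-- (`length-outside`). So distance at most `k` means that some common factor leaves contexts of
-- total length at most `k`. A maximal factor gives such contexts at once, and they differ because
-- `w ≢ w′` (`contexts-differ`). Conversely, a longest common factor, which exists by
-- `∃-maxCommonFactor`, leaves no more than the given `g` does.

IsFactorOf⇒++ : ∀ {f w : Word A} → f IsFactorOf w → ∃[ u ] ∃[ v ] w ≡ u ++ f ++ v
IsFactorOf⇒++ f⊑w with MkView u p v ← toView f⊑w with refl ← Pointwise-≡⇒≡ p =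
  u , v , refl

++-IsFactorOf : ∀ (u f v : Word A) → f IsFactorOf (u ++ f ++ v)
++-IsFactorOf u f v = fromView (MkView u (≡⇒Pointwise-≡ refl) v)

-- A factor is a prefix of a suffix. Repetitions in the list are harmless: only membership matters.
factors : Word A → List (Word A)
factors w = concatMap inits (tails w)

Prefix⇒∈inits : ∀ {f w : Word A} → Prefix _≡_ f w → f ∈ inits w
Prefix⇒∈inits []         = Any.here refl
Prefix⇒∈inits (refl ∷ p) = Any.there (∈-map⁺ (_ ∷_) (Prefix⇒∈inits p))

IsFactorOf⇒∈factors : ∀ {f w : Word A} → f IsFactorOf w → f ∈ factors w
IsFactorOf⇒∈factors (here p) = ∈-++⁺ˡ (Prefix⇒∈inits p)
IsFactorOf⇒∈factors (there {b = b} {bs = w} p) =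
  ∈-++⁺ʳ (inits (b ∷ w)) (IsFactorOf⇒∈factors p)

-- Finite search: every common factor occurs in `factors w`, and being one is decidable once letters
-- can be compared.
∃-maxCommonFactor : DecidableEquality A → ∀ (w w′ : Word A) →
                    ∃ (IsMaxCommonFactor w w′)
∃-maxCommonFactor {A = A} _≟_ w w′ = argmax ∣_∣ [] candidates , common , maximal
  where
  common? = λ f → infix? _≟_ f w ×-dec infix? _≟_ f w′

  candidates : List (Word A)
  candidates = filter common? (factors w)

  common : IsCommonFactor w w′ (argmax ∣_∣ [] candidates)
  -- `argmax` may return its default `[]`, so the empty word must be shown to be a common factor
  -- too.
  common = argmax-all ∣_∣ (++-IsFactorOf [] [] w , ++-IsFactorOf [] [] w′)
    (All.tabulate λ f∈ → proj₂ (∈-filter⁻ common? {xs = factors w} f∈))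

  maximal : ∀ g → IsCommonFactor w w′ g → ∣ g ∣ ≤ ∣ argmax ∣_∣ [] candidates ∣
  maximal g c@(g⊑w , _) = All.lookup (f[xs]≤f[argmax] [] candidates)
    (∈-filter⁺ common? (IsFactorOf⇒∈factors g⊑w) c)

-- `g` is counted once in each word, so the total is the context lengths plus exactly `2 * ∣ g ∣`,
-- and the truncated subtraction is exact.
length-outside : ∀ (u u′ v v′ g : Word A) →
  (∣ u ++ g ++ v ∣ + ∣ u′ ++ g ++ v′ ∣) ∸ 2 * ∣ g ∣ ≡
  ∣ u ∣ + ∣ u′ ∣ + ∣ v ∣ + ∣ v′ ∣
length-outside u u′ v v′ g = trans
  (cong (_∸ 2 * ∣ g ∣) (trans (cong₂ _+_ (length-++₃ u v) (length-++₃ u′ v′))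
    (solve 5 (λ x x′ y y′ z →
      (x :+ (z :+ y)) :+ (x′ :+ (z :+ y′)) :=
      (x :+ x′ :+ y :+ y′) :+ con 2 :* z)
      refl (∣ u ∣) (∣ u′ ∣) (∣ v ∣) (∣ v′ ∣) (∣ g ∣))))
  (m+n∸n≡m _ (2 * ∣ g ∣))
  where
  open +-*-Solver
  length-++₃ : ∀ x y → ∣ x ++ g ++ y ∣ ≡ ∣ x ∣ + (∣ g ∣ + ∣ y ∣)
  length-++₃ x y = trans (length-++ x) (cong (∣ x ∣ +_) (length-++ g))

-- Equal contexts around the same `g` would give equal words. Deciding `u` against `u′` selects the
-- disjunct constructively.
contexts-differ : DecidableEquality A → ∀ {u u′ g v v′ : Word A} →
                  u ++ g ++ v ≢ u′ ++ g ++ v′ → u ≢ u′ ⊎ v ≢ v′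
contexts-differ _≟_ {u} {u′} {g} w≢w′ with ≡-dec _≟_ u u′
... | no  u≢u′ = inj₁ u≢u′
... | yes refl = inj₂ λ v≡v′ → w≢w′ (cong (λ v → u ++ g ++ v) v≡v′)

lemma4p10 : ∀ {a : Level} (A : Set a) (n : ℕ) → A ↔ Fin n → 2 ≤ n →
    ∀ (k : ℕ) → 1 ≤ k →
    𝓕̲ {A = A} k ≐ (⋃[ (ω , _) ∶ ∃ (Ω′ {A = A} k) ] (S ω ∖ idA*))
lemma4p10 A n A↔Fin _ k _ = to , from
  where
  _≟_ : DecidableEquality A
  -- Finiteness of the alphabet enters here: letters are compared through their indices in `Fin n`.
  _≟_ = inj⇒≟ (↔⇒↣ A↔Fin)

  to : ∀ {p} → 𝓕̲ k p → (⋃[ (ω , _) ∶ ∃ (Ω′ k) ] (S ω ∖ idA*)) p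
  to ((f , ((f⊑w , f⊑w′) , _) , d≤k) , w≢w′)
    -- The tuple consists of what surrounds one occurrence of `f` in each word, with `f` itself as
    -- the shared middle.
    with u , v , refl ← IsFactorOf⇒++ f⊑w | u′ , v′ , refl ← IsFactorOf⇒++ f⊑w′ =
    ( (u , u′ , v , v′)
    , (z≤n , ≤-trans (≤-reflexive (sym (length-outside u u′ v v′ f))) d≤k)
    , contexts-differ _≟_ w≢w′)
    , (f , refl , refl) , w≢w′

  -- The middle word g need not be a longest common factor, but a longest one
  -- only makes the distance smaller.
  from : ∀ {p} → (⋃[ (ω , _) ∶ ∃ (Ω′ k) ] (S ω ∖ idA*)) p → 𝓕̲ k p
  from {w , w′} (((u , u′ , v , v′) , (_ , s≤k) , _) , (g , refl , refl) , w≢w′)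
    with f , f-max@(_ , longest) ← ∃-maxCommonFactor _≟_ w w′ =
    ( f , f-max
    , ≤-trans (∸-monoʳ-≤ (∣ w ∣ + ∣ w′ ∣) (*-monoʳ-≤ 2 g≤f))
        (≤-trans (≤-reflexive (length-outside u u′ v v′ g)) s≤k))
    , w≢w′
    where
    g≤f = longest g (++-IsFactorOf u g v , ++-IsFactorOf u′ g v′)
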